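{- For a given tricontext $\mathbb{K}=(G,M,B,I)$, $I\subseteq G\times M\times B$, and its associated triset system $\mathcal{T}=\{(X,Y,Z)\in 2^G\times 2^M\times 2^B \mid X\times Y\times Z\subseteq I\}$, the operator $h$ is not monotone with respect to $\sqsubseteq$.
   Context: A formal tricontext $\mathbb{K}=(G,M,B,I)$ consists of sets $G$, $M$, $B$ and a ternary relation $I\subseteq G\times M\times B$. A triset of $\mathbb{K}$ is a triple $(X,Y,Z)$ with $X\subseteq G$, $Y\subseteq M$, $Z\subseteq B$ and $X\times Y\times Z\subseteq I$ (components may be empty). For trisets, $(A_1,B_1,C_1)\sqsubseteq(A_2,B_2,C_2)$ means $A_1\times B_1\times C_1\subseteq A_2\times B_2\times C_2$. Monotone with respect to $\sqsubseteq$ means that $x\sqsubseteq y$ implies $h(x)\sqsubseteq h(y)$ for trisets $x,y\in\mathcal{T}$. The operator $h$ sends a triset $(X,Y,Z)$ of $\mathbb{K}$ to the triple $(U,V,W)$ where $U=\{g\in G\mid \forall m\in Y\ \forall b\in Z:\ (g,m,b)\in I\}$, $V=\{m\in M\mid \forall g\in U\ \forall b\in Z:\ (g,m,b)\in I\}$, $W=\{b\in B\mid \forall g\in U\ \forall m\in V:\ (g,m,b)\in I\}$. -}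

module Defs where

open import Data.Product using (_×_; _,_)
open import Level using (0ℓ)
open import Relation.Binary.Core using (Rel)
open import Relation.Unary using (Pred; _∈_; _⊆_; _⟨×⟩_)

record Tricontext : Set₁ where
  field
    G M B : Set
    I     : Pred (G × M × B) 0ℓ

module _ (𝕂 : Tricontext) where
  open Tricontext 𝕂

  record Triset : Set₁ where
    constructor triset
    field
      X   : Pred G 0ℓ
      Y   : Pred M 0ℓ
      Z   : Pred B 0ℓ
      box : (X ⟨×⟩ Y ⟨×⟩ Z) ⊆ I

  -- Only the products are compared, so all trisets with an empty component
  -- lie below every triset: this is a preorder, not componentwise inclusion.
  _⊑_ : Rel Triset 0ℓ
  s ⊑ t = (S.X ⟨×⟩ S.Y ⟨×⟩ S.Z) ⊆ (T.X ⟨×⟩ T.Y ⟨×⟩ T.Z)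
    where
    module S = Triset s
    module T = Triset t

  h : Triset → Triset
  h (triset X Y Z _) = triset U V W λ (g∈U , m∈V , b∈W) → b∈W _ g∈U _ m∈V
    where
    U : Pred G 0ℓ
    U g = ∀ m → m ∈ Y → ∀ b → b ∈ Z → (g , m , b) ∈ I

    V : Pred M 0ℓ
    V m = ∀ g → g ∈ U → ∀ b → b ∈ Z → (g , m , b) ∈ I

    W : Pred B 0ℓ
    W b = ∀ g → g ∈ U → ∀ m → m ∈ V → (g , m , b) ∈ I

{-# OPTIONS --safe #-}

-- Enlarging the attributes of a triset shrinks the object component of its
-- image under h. Let I hold everywhere except at (false , false , tt). Then
-- ({true},{true},{tt}) is mapped to ({true,false},{true},{tt}), while the larger
-- ({true},{true,false},{tt}) is fixed by h, so (false , true , tt) is lost.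
-- All components are nonempty, so the failure does not come from the degenerate
-- trisets with empty product.
module Submission where

open import Data.Bool using (Bool; true; false; T)
open import Data.Product using (Σ-syntax; _×_; _,_)
open import Data.Sum using (_⊎_; inj₁; inj₂; reduce)
open import Data.Unit using (⊤; tt)
open import Relation.Binary.Definitions using (Monotonic₁)
open import Relation.Nullary using (¬_)
open import Relation.Unary using (_∈_; _⟨×⟩_; U)
open import Defs

𝕂₀ : Tricontext
𝕂₀ = record { G = Bool ; M = Bool ; B = ⊤ ; I = λ (g , m , _) → T g ⊎ T m }

small large : Triset 𝕂₀
small = triset T T U λ (g∈X , _) → inj₁ g∈X
large = triset T U U λ (g∈X , _) → inj₁ g∈X

small⊑large : _⊑_ 𝕂₀ small large
small⊑large (g∈X , _ , b∈Z) = g∈X , tt , b∈Z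

product : Triset 𝕂₀ → Bool × Bool × ⊤ → Set
product t = X ⟨×⟩ Y ⟨×⟩ Z
  where open Triset t

-- The only attribute of `small` is `true`, which is incident with every object, so `false` enters
-- the object component of the image.
lost∈h-small : (false , true , tt) ∈ product (h 𝕂₀ small)
lost∈h-small =
  (λ _ m∈Y _ _ → inj₂ m∈Y) ,
  (λ _ _ _ _ → inj₂ tt) ,
  -- The sole condition `tt` already lies in the third component of `small`.
  (λ g g∈U m m∈V → m∈V g g∈U tt tt)

lost∉h-large : ¬ (false , true , tt) ∈ product (h 𝕂₀ large)
lost∉h-large (false∈U , _) = reduce (false∈U false tt tt tt)

theorem2 : Σ[ 𝕂 ∈ Tricontext ] ¬ Monotonic₁ (_⊑_ 𝕂) (_⊑_ 𝕂) (h 𝕂)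
theorem2 = 𝕂₀ , λ mono → lost∉h-large
  (mono {small} {large} (λ {x} → small⊑large {x}) {false , true , tt} lost∈h-small)
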